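{- For any unimodal range map $\delta$, the minimal generating set $\mathfrak{G}_\delta=\{\mathsf{E}_w:w\in\mathcal{P}_\delta\}$ of the operad $\mathbf{Cl}_\delta$ is finite if and only if $\delta$ is $1$-dominated.
   Context: $\mathbb{N}=\{0,1,2,\dots\}$ and $\mathbb{K}$ is a field of characteristic zero. A range map is a map $\delta:\mathbb{N}\setminus\{0\}\to\mathbb{N}$. It is unimodal if there are no $1\le i_1<i_2<i_3$ with $\delta(i_1)>\delta(i_2)<\delta(i_3)$. It is $1$-dominated if there is a $k\ge1$ such that $\delta(1)\ge\delta(k')$ for all $k'\ge k$. For a word $w$ on $\mathbb{N}$, $\ell(w)$ is its length, $w(i)$ its $i$-th letter, $\epsilon$ is the empty word. A $\delta$-cliff is a word $w$ on $\mathbb{N}$ with $0\le w(i)\le\delta(i)$ for all $i$; its size is $|w|:=\ell(w)+1$; $\mathsf{Cl}_\delta$ is the graded set of all $\delta$-cliffs. For words $u,v$ and $1\le i\le|u|$, $u\,\square_i\,v:=u(1)\cdots u(i-1)\;v\;u(i)\cdots u(\ell(u))$. For $\delta$ unimodal, $\mathbf{Cl}_\delta$ is the nonsymmetric operad over $\mathbb{K}$ with basis $\{\mathsf{E}_w:w\in\mathsf{Cl}_\delta\}$ ($\mathsf{E}_w$ of arity $|w|$), partial compositions $\mathsf{E}_u\circ_i\mathsf{E}_v=\mathsf{E}_{u\,\square_i\,v}$ if $u\,\square_i\,v\in\mathsf{Cl}_\delta$ and $\mathsf{E}_u\circ_i\mathsf{E}_v=0$ otherwise, and unit $\mathsf{E}_\epsilon$.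 A nonempty $\delta$-cliff $w$ is $\delta$-prime if $w=u\,\square_i\,v$ with $u,v\in\mathsf{Cl}_\delta$ and $1\le i\le|u|$ implies $(u,v)\in\{(w,\epsilon),(\epsilon,w)\}$. $\mathcal{P}_\delta$ is the set of all $\delta$-prime $\delta$-cliffs. The set $\mathfrak{G}_\delta$ generates $\mathbf{Cl}_\delta$ as an operad and no proper subset of it does. -}

module Defs where

open import Algebra.Apartness.Bundles using (HeytingField; HeytingCommutativeRing)
open import Algebra.Bundles using (CommutativeRing; AbelianGroup)
import Algebra.Definitions.RawMonoid as RawMonoidDefinitions
open import Algebra.Module.Bundles using (Module)
open import Algebra.Module.Structures.Biased using (IsModuleFromLeft)
import Algebra.Construct.Pointwise as Pointwise
import Algebra.Properties.CommutativeSemigroup as CommutativeSemigroupProperties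
open import Data.Empty using (⊥-elim)
open import Data.Fin.Base as Fin using (Fin; toℕ; fromℕ<)
open import Data.Fin.Properties using (toℕ-fromℕ<; toℕ≤pred[n]; any?)
open import Data.List.Base
  using (List; []; _∷_; _++_; length; lookup; take; drop; map; concatMap; upTo)
open import Data.List.Membership.Propositional using (_∈_; _∉_; lose)
open import Data.List.Membership.Propositional.Properties
  using (∈-concatMap⁺; ∈-map⁺; ∈-upTo⁺)
open import Data.List.Properties
  using (++-assoc; ++-identityʳ; length-++; take++drop≡id; length-take; ≡-dec)
open import Data.List.Relation.Unary.Any using (Any; here; there)
open import Data.Nat.Base
open import Data.Nat.Properties
open import Data.Nat.Solver using (module +-*-Solver)
open import Data.Product.Base
  using (Σ; ∃; ∃-syntax; ∃₂; _×_; _,_; proj₁; proj₂)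
open import Data.Sum.Base using (_⊎_; inj₁; inj₂)
open import Function.Bundles using (_⇔_)
open import Level using (Level) renaming (_⊔_ to _⊔ˡ_; suc to sucˡ)
open import Relation.Binary.PropositionalEquality as ≡
  using (_≡_; _≢_; refl; cong; cong₂; subst)
import Relation.Binary.Reasoning.Setoid as SetoidReasoning
open import Relation.Nullary
  using (¬_; Dec; yes; no; recompute; contradiction; ¬?; _×-dec_)
open import Relation.Nullary.Decidable using (map′)

open +-*-Solver using (solve; _:+_; _:=_)

private
  variable
    r ℓ₁ ℓ₂ ℓr m ℓm p q : Level

-- Fields are Heyting fields; classically these are all fields, with _#_ the
-- negation of _≈_.
fieldRing : HeytingField r ℓ₁ ℓ₂ → CommutativeRing r ℓ₁
fieldRing K = HeytingCommutativeRing.commutativeRing (HeytingField.heytingCommutativeRing K)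

CharacteristicZero : HeytingField r ℓ₁ ℓ₂ → Set ℓ₁
CharacteristicZero K = ∀ n → ¬ (suc n · 1# ≈ 0#)
  where
  open CommutativeRing (fieldRing K)
  open RawMonoidDefinitions +-rawMonoid using () renaming (_×_ to infixr 8 _·_)

+-swapʳ : ∀ l m n → l + m + n ≡ l + n + m
+-swapʳ = CommutativeSemigroupProperties.xy∙z≈xz∙y +-commutativeSemigroup

-- All operations have positive arity: Op n is the module of operations
-- of arity n + 1, and inputs are numbered from 0.
record NSOperad (R : CommutativeRing r ℓr) m ℓm : Set (r ⊔ˡ ℓr ⊔ˡ sucˡ (m ⊔ˡ ℓm)) where
  infixl 8 _∘⟨_⟩_

  field
    Op : ℕ → Module R m ℓm

  O : ℕ → Set m
  O n = Module.Carrierᴹ (Op n)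

  open module Opₙ {n} = Module (Op n) public using (_≈ᴹ_; _+ᴹ_; _*ₗ_; 0ᴹ)

  field
    _∘⟨_⟩_ : ∀ {m n} → O m → Fin (suc m) → O n → O (m + n)
    id     : O 0

    ∘-cong : ∀ {m n} {x x′ : O m} {y y′ : O n} i →
             x ≈ᴹ x′ → y ≈ᴹ y′ → x ∘⟨ i ⟩ y ≈ᴹ x′ ∘⟨ i ⟩ y′

    ∘-+ˡ : ∀ {m n} (x x′ : O m) i (y : O n) →
           (x +ᴹ x′) ∘⟨ i ⟩ y ≈ᴹ x ∘⟨ i ⟩ y +ᴹ x′ ∘⟨ i ⟩ y
    ∘-+ʳ : ∀ {m n} (x : O m) i (y y′ : O n) →
           x ∘⟨ i ⟩ (y +ᴹ y′) ≈ᴹ x ∘⟨ i ⟩ y +ᴹ x ∘⟨ i ⟩ y′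
    ∘-*ˡ : ∀ {m n} a (x : O m) i (y : O n) →
           (a *ₗ x) ∘⟨ i ⟩ y ≈ᴹ a *ₗ (x ∘⟨ i ⟩ y)
    ∘-*ʳ : ∀ {m n} a (x : O m) i (y : O n) →
           x ∘⟨ i ⟩ (a *ₗ y) ≈ᴹ a *ₗ (x ∘⟨ i ⟩ y)

    identityˡ : ∀ {n} (x : O n) → id ∘⟨ Fin.zero ⟩ x ≈ᴹ x
    identityʳ : ∀ {n} (x : O n) i → subst O (+-identityʳ n) (x ∘⟨ i ⟩ id) ≈ᴹ x

    sequential : ∀ {l m n} (x : O l) (y : O m) (z : O n)
                 (i : Fin (suc l)) (j : Fin (suc m)) (k : Fin (suc (l + m))) →
                 toℕ k ≡ toℕ i + toℕ j →
                 subst O (+-assoc l m n) ((x ∘⟨ i ⟩ y) ∘⟨ k ⟩ z) ≈ᴹ x ∘⟨ i ⟩ (y ∘⟨ j ⟩ z)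
    parallel   : ∀ {l m n} (x : O l) (y : O m) (z : O n)
                 (i j : Fin (suc l)) (k : Fin (suc (l + m))) (i′ : Fin (suc (l + n))) →
                 toℕ i < toℕ j → toℕ k ≡ toℕ j + m → toℕ i′ ≡ toℕ i →
                 subst O (+-swapʳ l m n) ((x ∘⟨ i ⟩ y) ∘⟨ k ⟩ z) ≈ᴹ (x ∘⟨ j ⟩ z) ∘⟨ i′ ⟩ y

module _ {R : CommutativeRing r ℓr} (𝐎 : NSOperad R m ℓm) where
  open NSOperad 𝐎

  record GradedSubset p : Set (m ⊔ˡ ℓm ⊔ˡ sucˡ p) where
    field
      member   : ∀ {n} → O n → Set p
      respects : ∀ {n} {x y : O n} → x ≈ᴹ y → member x → member y

  open GradedSubset

  infix 4 _⊆ᴳ_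
  _⊆ᴳ_ : GradedSubset p → GradedSubset q → Set _
  S ⊆ᴳ T = ∀ {n} (x : O n) → member S x → member T x

  data Generated (S : GradedSubset p) : ∀ {n} → O n → Set (r ⊔ˡ m ⊔ˡ ℓm ⊔ˡ p) where
    gen  : ∀ {n} {x : O n} → member S x → Generated S x
    unit : Generated S id
    comp : ∀ {m n} {x : O m} {y : O n} i →
           Generated S x → Generated S y → Generated S (x ∘⟨ i ⟩ y)
    zero : ∀ {n} → Generated S (0ᴹ {n})
    add  : ∀ {n} {x y : O n} → Generated S x → Generated S y → Generated S (x +ᴹ y)
    scal : ∀ {n} a {x : O n} → Generated S x → Generated S (a *ₗ x)
    resp : ∀ {n} {x y : O n} → x ≈ᴹ y → Generated S x → Generated S y

  Generates : GradedSubset p → Set _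
  Generates S = ∀ {n} (x : O n) → Generated S x

  record MinimalGeneratingSet p : Set (r ⊔ˡ m ⊔ˡ ℓm ⊔ˡ sucˡ p) where
    field
      generators : GradedSubset p
      generates  : Generates generators
      -- No proper subset generates, stated without negation.
      minimal    : (T : GradedSubset p) → T ⊆ᴳ generators → Generates T → generators ⊆ᴳ T

  infix 4 _≋_
  _≋_ : ∃ O → ∃ O → Set ℓm
  (m , x) ≋ (n , y) = Σ (m ≡ n) λ eq → subst O eq x ≈ᴹ y

  Finite : GradedSubset p → Set _
  Finite S = ∃[ xs ] (∀ {n} (x : O n) → member S x ⇔ Any ((n , x) ≋_) xs)

RangeMap : Set
RangeMap = (i : ℕ) → .{{NonZero i}} → ℕ

Unimodal : RangeMap → Set
Unimodal δ = ∀ i₁ i₂ i₃ .{{_ : NonZero i₁}} .{{_ : NonZero i₂}} .{{_ : NonZero i₃}} →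
             i₁ < i₂ → i₂ < i₃ → ¬ (δ i₁ > δ i₂ × δ i₂ < δ i₃)

OneDominated : RangeMap → Set
OneDominated δ = ∃[ k ] (k ≥ 1 × (∀ k′ .{{_ : NonZero k′}} → k′ ≥ k → δ 1 ≥ δ k′))

Word : Set
Word = List ℕ

size : Word → ℕ
size w = suc (length w)

IsCliff : RangeMap → Word → Set
IsCliff δ w = ∀ i → lookup w i ≤ δ (suc (toℕ i))

-- The position i is numbered from 0.
infix 6 _□⟨_⟩_
_□⟨_⟩_ : (u : Word) → Fin (size u) → Word → Word
u □⟨ i ⟩ v = take (toℕ i) u ++ v ++ drop (toℕ i) u

record IsPrime (δ : RangeMap) (w : Word) : Set where
  field
    nonempty       : w ≢ []
    isCliff        : IsCliff δ w
    indecomposable : ∀ u v i → IsCliff δ u → IsCliff δ v → w ≡ u □⟨ i ⟩ v →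
                     (u ≡ w × v ≡ []) ⊎ (u ≡ [] × v ≡ w)

-- The δ-cliffs of size n + 1; irrelevance makes two of them equal as soon
-- as their words are.
record Cliff (δ : RangeMap) (n : ℕ) : Set where
  constructor mkCliff
  field
    word     : Word
    .isCliff : IsCliff δ word
    .length≡ : length word ≡ n

open Cliff

take-length : ∀ {A : Set} (a b : List A) → take (length a) (a ++ b) ≡ a
take-length []      b = refl
take-length (x ∷ a) b = cong (x ∷_) (take-length a b)

drop-length : ∀ {A : Set} (a b : List A) → drop (length a) (a ++ b) ≡ b
drop-length []      b = refl
drop-length (x ∷ a) b = drop-length a b

-- The factor of length n starting after i letters, and what remains when
-- it is removed: the u and v with u □⟨ i ⟩ v ≡ w and length v ≡ n.
inner outer : ℕ → ℕ → Word → Word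
inner i n w = take n (drop i w)
outer i n w = take i w ++ drop n (drop i w)

inner-++ : ∀ a v b → inner (length a) (length v) (a ++ v ++ b) ≡ v
inner-++ a v b rewrite drop-length a (v ++ b) = take-length v b

outer-++ : ∀ a v b → outer (length a) (length v) (a ++ v ++ b) ≡ a ++ b
outer-++ a v b rewrite take-length a (v ++ b) | drop-length a (v ++ b) =
  cong (a ++_) (drop-length v b)

cut : ∀ i (w : Word) → i ≤ length w → ∃₂ λ a b → w ≡ a ++ b × length a ≡ i
cut i w i≤ = take i w , drop i w , ≡.sym (take++drop≡id i w)
           , ≡.trans (length-take i w) (m≤n⇒m⊓n≡m i≤)

cut′ : ∀ i {n} (w : Word) → length w ≡ i + n →
       ∃₂ λ a b → w ≡ a ++ b × length a ≡ i × length b ≡ n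
cut′ i w eq with cut i w (subst (i ≤_) (≡.sym eq) (m≤m+n i _))
... | a , b , refl , refl =
  a , b , refl , refl , +-cancelˡ-≡ (length a) _ _ (≡.trans (≡.sym (length-++ a)) eq)

length-++₃ : ∀ (a b c : Word) → length (a ++ b ++ c) ≡ length (a ++ c) + length b
length-++₃ a b c
  rewrite length-++ a {b ++ c} | length-++ b {c} | length-++ a {c}
        | +-comm (length b) (length c) = ≡.sym (+-assoc (length a) _ _)

++-bare : ∀ (a v b : Word) → a ++ b ≡ [] → a ++ v ++ b ≡ v
++-bare [] v [] _ = ++-identityʳ v

length≡0⇒[] : ∀ {w : Word} → length w ≡ 0 → w ≡ []
length≡0⇒[] {[]} _ = refl

□-++ : ∀ a v b (i : Fin (size (a ++ b))) → toℕ i ≡ length a →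
       (a ++ b) □⟨ i ⟩ v ≡ a ++ v ++ b
□-++ a v b i eq rewrite eq | take-length a b | drop-length a b = refl

split-at : ∀ (u : Word) (i : Fin (size u)) → ∃₂ λ a b → u ≡ a ++ b × length a ≡ toℕ i
split-at u i = cut (toℕ i) u (toℕ≤pred[n] i)

outer-□ : ∀ u i v → outer (toℕ i) (length v) (u □⟨ i ⟩ v) ≡ u
outer-□ u i v with split-at u i
... | a , b , refl , eqa rewrite □-++ a v b i (≡.sym eqa) | ≡.sym eqa = outer-++ a v b

inner-□ : ∀ u i v → inner (toℕ i) (length v) (u □⟨ i ⟩ v) ≡ v
inner-□ u i v with split-at u i
... | a , b , refl , eqa rewrite □-++ a v b i (≡.sym eqa) | ≡.sym eqa = inner-++ a v b

length-□ : ∀ u i v → length (u □⟨ i ⟩ v) ≡ length u + length v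
length-□ u i v with split-at u i
... | a , b , refl , eqa rewrite □-++ a v b i (≡.sym eqa) = length-++₃ a v b

+-rotate : ∀ i l n → i + l + n ≡ i + (n + l)
+-rotate = solve 3 (λ i l n → i :+ l :+ n := i :+ (n :+ l)) refl

+-nest : ∀ i j l n → i + (j + l + n) ≡ i + j + l + n
+-nest = solve 4 (λ i j l n → i :+ (j :+ l :+ n) := i :+ j :+ l :+ n) refl

decompose₁ : ∀ i l n (w : Word) → i ≤ l → length w ≡ l + n →
  ∃₂ λ a v → ∃[ b ] (w ≡ a ++ v ++ b × length a ≡ i × length v ≡ n × length (a ++ b) ≡ l)
decompose₁ i l n w i≤l len with m≤n⇒∃[o]m+o≡n i≤l
... | l′ , refl with cut′ i {n + l′} w (≡.trans len (+-rotate i l′ n))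
...   | a , r , refl , eqa , eqr with cut′ n r eqr
...     | v , b , refl , eqv , eqb =
  a , v , b , refl , eqa , eqv , ≡.trans (length-++ a) (cong₂ _+_ eqa eqb)

SeqDecomposition : (i j l m n : ℕ) → Word → Set
SeqDecomposition i j l m n w =
  ∃₂ λ a b → ∃₂ λ c d → ∃[ e ] (w ≡ a ++ (b ++ c ++ d) ++ e ×
    length a ≡ i × length b ≡ j × length c ≡ n × length (b ++ d) ≡ m × length (a ++ e) ≡ l)

decompose-seq : ∀ i j l m n w → i ≤ l → j ≤ m → length w ≡ l + (m + n) →
                SeqDecomposition i j l m n w
decompose-seq i j l m n w i≤l j≤m len with decompose₁ i l (m + n) w i≤l len
... | a , r , e , refl , eqa , eqr , eqae with decompose₁ j m n r j≤m eqr
...   | b , c , d , refl , eqb , eqc , eqbd =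
  a , b , c , d , e , refl , eqa , eqb , eqc , eqbd , eqae

ParDecomposition : (i j l m n : ℕ) → Word → Set
ParDecomposition i j l m n w =
  ∃₂ λ a b → ∃₂ λ c d → ∃[ e ] (w ≡ a ++ b ++ c ++ d ++ e ×
    length a ≡ i × length b ≡ m × length (a ++ c) ≡ j × length d ≡ n × length (a ++ c ++ e) ≡ l)

decompose-par : ∀ i j l m n w → i ≤ j → j ≤ l → length w ≡ l + n + m →
                ParDecomposition i j l m n w
decompose-par i j l m n w i≤j j≤l len with m≤n⇒∃[o]m+o≡n i≤j
... | j′ , refl with m≤n⇒∃[o]m+o≡n j≤l
...   | l′ , refl with decompose₁ i (i + j′ + l′ + n) m w
                         (≤-trans (m≤m+n i (j′ + l′ + n)) (≤-reflexive
                           (+-nest i j′ l′ n)))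
                         len
...     | a , b , r , refl , eqa , eqb , eqar with decompose₁ j′ (j′ + l′) n r (m≤m+n j′ l′)
              (+-cancelˡ-≡ i _ _ (≡.trans (cong (_+ length r) (≡.sym eqa))
                (≡.trans (≡.sym (length-++ a)) (≡.trans eqar
                  (≡.sym (+-nest i j′ l′ n))))))
...       | c , d , e , refl , eqc , eqd , eqce =
  a , b , c , d , e , refl , eqa , eqb , ≡.trans (length-++ a) (cong₂ _+_ eqa eqc) , eqd
  , ≡.trans (length-++ a) (≡.trans (cong₂ _+_ eqa eqce) (≡.sym (+-assoc i j′ l′)))

module Offset (δ : RangeMap) where

  δ⁺ : ℕ → ℕ
  δ⁺ i = δ (suc i)

  data From : ℕ → Word → Set where
    []  : ∀ {o} → From o []
    _∷_ : ∀ {o x w} → x ≤ δ⁺ o → From (suc o) w → From o (x ∷ w)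

  from : ∀ o w → (∀ i → lookup w i ≤ δ⁺ (o + toℕ i)) → From o w
  from o []      h = []
  from o (x ∷ w) h =
    subst (λ k → x ≤ δ⁺ k) (+-identityʳ o) (h Fin.zero) ∷
    from (suc o) w λ i → subst (λ k → lookup w i ≤ δ⁺ k) (+-suc o (toℕ i)) (h (Fin.suc i))

  unfrom : ∀ {o w} → From o w → ∀ i → lookup w i ≤ δ⁺ (o + toℕ i)
  unfrom {o} {x ∷ w} (x≤ ∷ _)  Fin.zero    = subst (λ k → x ≤ δ⁺ k) (≡.sym (+-identityʳ o)) x≤
  unfrom {o} {x ∷ w} (_  ∷ ws) (Fin.suc i) =
    subst (λ k → lookup w i ≤ δ⁺ k) (≡.sym (+-suc o (toℕ i))) (unfrom ws i)

  cliff⇒from : ∀ {w} → IsCliff δ w → From 0 w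
  cliff⇒from = from 0 _

  from⇒cliff : ∀ {w} → From 0 w → IsCliff δ w
  from⇒cliff = unfrom

  from? : ∀ o w → Dec (From o w)
  from? o []      = yes []
  from? o (x ∷ w) = map′ (λ (a , b) → a ∷ b) (λ { (a ∷ b) → a , b })
                         (x ≤? δ⁺ o ×-dec from? (suc o) w)

  glue : ∀ {o} a {b} → From o a → From (length a + o) b → From o (a ++ b)
  glue []      []       q = q
  glue (x ∷ a) {b} (x≤ ∷ p) q =
    x≤ ∷ glue a p (subst (λ k → From k b) (≡.sym (+-suc (length a) _)) q)

  unglue : ∀ {o} a {b} → From o (a ++ b) → From o a × From (length a + o) b
  unglue []      q = [] , q
  unglue (x ∷ a) {b} (x≤ ∷ p) with unglue a p
  ... | pa , pb = x≤ ∷ pa , subst (λ k → From k b) (+-suc (length a) _) pb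

  isCliff? : ∀ w → Dec (IsCliff δ w)
  isCliff? w = map′ from⇒cliff cliff⇒from (from? 0 w)

  cliffWord : ∀ {n} (c : Cliff δ n) → IsCliff δ (word c)
  cliffWord (mkCliff w p _) = recompute (isCliff? w) p

  cliffLength : ∀ {n} (c : Cliff δ n) → length (word c) ≡ n
  cliffLength {n} (mkCliff w _ q) = recompute (length w ≟ n) q

  words : ℕ → ℕ → List Word
  words o zero    = [] ∷ []
  words o (suc n) = concatMap (λ x → map (x ∷_) (words (suc o) n)) (upTo (suc (δ⁺ o)))

  ∈-words : ∀ {o w} → From o w → w ∈ words o (length w)
  ∈-words [] = here refl
  ∈-words {w = x ∷ w} (x≤ ∷ p) =
    ∈-concatMap⁺ _ (lose (∈-upTo⁺ (s≤s x≤)) (∈-map⁺ (x ∷_) (∈-words p)))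

  prime⊎composite : ∀ w → IsCliff δ w → w ≢ [] →
    IsPrime δ w ⊎
    ∃₂ λ u v → ∃[ i ] (IsCliff δ u × IsCliff δ v × w ≡ u □⟨ i ⟩ v ×
                       length u < length w × length v < length w)
  prime⊎composite w cl w≢[] with any? {n = suc (length w)} (λ i → any? {n = suc (length w)} (λ n →
      toℕ i + toℕ n ≤? length w ×-dec ¬? (toℕ n ≟ 0) ×-dec ¬? (toℕ n ≟ length w) ×-dec
      isCliff? (outer (toℕ i) (toℕ n) w) ×-dec isCliff? (inner (toℕ i) (toℕ n) w)))
  ... | no none = inj₁ record
    { nonempty = w≢[] ; isCliff = cl
    ; indecomposable = λ u v i cu cv eq → split u v (toℕ i) (toℕ≤pred[n] i) cu cv eq }
    where
    split : ∀ u v i → i ≤ length u → IsCliff δ u → IsCliff δ v →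
            w ≡ take i u ++ v ++ drop i u → (u ≡ w × v ≡ []) ⊎ (u ≡ [] × v ≡ w)
    split u v i i≤ cu cv eq with cut i u i≤
    split u v i i≤ cu cv eq | a , b , refl , refl
      rewrite take-length a b | drop-length a b with v | cv
    ... | [] | _ = inj₁ (≡.sym eq , refl)
    ... | v@(_ ∷ _) | cv with length v ≟ length w
    ...   | yes v≡w = inj₂ (ab≡[] , ≡.trans (≡.sym v-ab) (≡.sym eq))
      where
      |ab| : length (a ++ b) ≡ 0
      |ab| = +-cancelʳ-≡ (length v) _ 0
        (≡.trans (≡.sym (length-++₃ a v b)) (≡.trans (cong length (≡.sym eq)) (≡.sym v≡w)))
      ab≡[] : a ++ b ≡ []
      ab≡[] = length≡0⇒[] |ab|
      v-ab : a ++ v ++ b ≡ v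
      v-ab = ++-bare a v b ab≡[]
    ...   | no v≢w = ⊥-elim (none (fromℕ< i< , fromℕ< n< , goal))
      where
      total : length a + length v ≤ length w
      total = subst (length a + length v ≤_)
        (≡.trans (≡.sym (length-++₃ a v b)) (cong length (≡.sym eq)))
        (+-monoˡ-≤ (length v) (subst (length a ≤_) (≡.sym (length-++ a)) (m≤m+n _ _)))
      i< : length a < suc (length w)
      i< = s≤s (≤-trans (m≤m+n _ _) total)
      n< : length v < suc (length w)
      n< = s≤s (≤-trans (m≤n+m _ (length a)) total)
      goal : toℕ (fromℕ< i<) + toℕ (fromℕ< n<) ≤ length w × ¬ toℕ (fromℕ< n<) ≡ 0 ×
             ¬ toℕ (fromℕ< n<) ≡ length w ×
             IsCliff δ (outer (toℕ (fromℕ< i<)) (toℕ (fromℕ< n<)) w) ×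
             IsCliff δ (inner (toℕ (fromℕ< i<)) (toℕ (fromℕ< n<)) w)
      goal rewrite toℕ-fromℕ< i< | toℕ-fromℕ< n< =
        total , (λ ()) , v≢w ,
        subst (IsCliff δ) (≡.sym (≡.trans (cong (outer (length a) (length v)) eq) (outer-++ a v b))) cu ,
        subst (IsCliff δ) (≡.sym (≡.trans (cong (inner (length a) (length v)) eq) (inner-++ a v b))) cv
  ... | yes (i , n , i+n≤ , n≢0 , n≢w , cu , cv) =
    composite (toℕ i) (toℕ n) i+n≤ n≢0 n≢w cu cv
    where
    composite : ∀ i n → i + n ≤ length w → n ≢ 0 → n ≢ length w →
      IsCliff δ (outer i n w) → IsCliff δ (inner i n w) → _
    composite i n i+n≤ n≢0 n≢w cu cv with cut i w (≤-trans (m≤m+n i n) i+n≤)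
    ... | a , vb , refl , refl with cut n vb (+-cancelˡ-≤ (length a) _ _
                                      (subst (_ ≤_) (length-++ a) i+n≤))
    ...   | v , b , refl , refl
      rewrite outer-++ a v b | inner-++ a v b = inj₂
        ( a ++ b , v , fromℕ< i< , cu , cv
        , ≡.sym (cong₂ (λ s t → s ++ v ++ t)
            (≡.trans (cong (λ k → take k (a ++ b)) (toℕ-fromℕ< i<)) (take-length a b))
            (≡.trans (cong (λ k → drop k (a ++ b)) (toℕ-fromℕ< i<)) (drop-length a b)))
        , subst (length (a ++ b) <_) (≡.sym (length-++₃ a v b))
            (m<m+n _ (n≢0⇒n>0 n≢0))
        , ≤∧≢⇒< (≤-trans (m≤n+m _ (length a)) i+n≤) n≢w )
      where
      i< : length a < suc (length (a ++ b))
      i< = s≤s (subst (length a ≤_) (≡.sym (length-++ a)) (m≤m+n _ _))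

  module Closed (unimodal : Unimodal δ) where

    between-letter : ∀ {x a b c} → a ≤ b → b ≤ c → x ≤ δ⁺ a → x ≤ δ⁺ c → x ≤ δ⁺ b
    between-letter {x} {a} {b} {c} a≤b b≤c x≤a x≤c with x ≤? δ⁺ b | a ≟ b | b ≟ c
    ... | yes x≤b | _        | _        = x≤b
    ... | no _    | yes refl | _        = x≤a
    ... | no _    | no _     | yes refl = x≤c
    ... | no x≰b  | no a≢b   | no b≢c   = contradiction
      (<-≤-trans (≰⇒> x≰b) x≤a , <-≤-trans (≰⇒> x≰b) x≤c)
      (unimodal (suc a) (suc b) (suc c) (s≤s (≤∧≢⇒< a≤b a≢b)) (s≤s (≤∧≢⇒< b≤c b≢c)))

    between : ∀ {a b c w} → a ≤ b → b ≤ c → From a w → From c w → From b w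
    between a≤b b≤c []       []       = []
    between a≤b b≤c (x ∷ xs) (y ∷ ys) =
      between-letter a≤b b≤c x y ∷ between (s≤s a≤b) (s≤s b≤c) xs ys

    module _ a b c d e (W : IsCliff δ (a ++ (b ++ c ++ d) ++ e)) where

      seq-closed₁ : IsCliff δ (a ++ e) → IsCliff δ (b ++ d) → IsCliff δ (a ++ (b ++ d) ++ e)
      seq-closed₁ ae bd with unglue a (cliff⇒from W) | unglue a (cliff⇒from ae) | unglue b (cliff⇒from bd)
      ... | wa , wr | _ , ae-e | _ , bd-d with unglue (b ++ c ++ d) wr
      ...   | wbcd , we with unglue b wbcd
      ...     | wb , wcd with unglue c wcd
      ...       | _ , wd = from⇒cliff (glue a wa (glue (b ++ d)
        (glue b wb (between (+-monoʳ-≤ (length b) z≤n) (m≤n+m _ (length c)) bd-d wd))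
        (between (m≤n+m _ (length (b ++ d)))
                 (+-monoˡ-≤ _ (subst (length (b ++ d) ≤_) (≡.sym (length-++₃ b c d)) (m≤m+n _ _)))
                 ae-e we)))

      seq-closed₂ : IsCliff δ (b ++ d) → IsCliff δ c → IsCliff δ (b ++ c ++ d)
      seq-closed₂ bd cc with unglue a (cliff⇒from W) | unglue b (cliff⇒from bd)
      ... | wa , wr | bd-b , bd-d with unglue (b ++ c ++ d) wr
      ...   | wbcd , we with unglue b wbcd
      ...     | wb , wcd with unglue c wcd
      ...       | wc , wd = from⇒cliff (glue b bd-b (glue c
        (between z≤n (+-monoʳ-≤ (length b) z≤n) (cliff⇒from cc) wc)
        (between (m≤n+m _ (length c)) (+-monoʳ-≤ (length c) (+-monoʳ-≤ (length b) z≤n)) bd-d wd)))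

    module _ a b c d e (W : IsCliff δ (a ++ b ++ c ++ d ++ e)) where

      par-closed₁ : IsCliff δ (a ++ c ++ e) → IsCliff δ b → IsCliff δ (a ++ b ++ c ++ e)
      par-closed₁ ace _ with unglue a (cliff⇒from W) | unglue a (cliff⇒from ace)
      ... | wa , w₁ | _ , ce with unglue b w₁ | unglue c ce
      ...   | wb , w₂ | _ , ace-e with unglue c w₂
      ...     | wc , w₃ with unglue d w₃
      ...       | _ , we = from⇒cliff (glue a wa (glue b wb (glue c wc
        (between (+-monoʳ-≤ (length c) (m≤n+m _ (length b))) (m≤n+m _ (length d)) ace-e we))))

      par-closed₂ : IsCliff δ ((a ++ c) ++ e) → IsCliff δ d → IsCliff δ ((a ++ c) ++ d ++ e)
      par-closed₂ ace dd
        with unglue a (cliff⇒from W)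
           | unglue a (cliff⇒from (subst (IsCliff δ) (++-assoc a c e) ace))
      ... | wa , w₁ | _ , ce with unglue b w₁ | unglue c ce
      ...   | wb , w₂ | ace-c , ace-e with unglue c w₂
      ...     | wc , w₃ with unglue d w₃
      ...       | wd , we = subst (IsCliff δ) (≡.sym (++-assoc a c (d ++ e)))
        (from⇒cliff (glue a wa (glue c ace-c (glue d
          (between z≤n (+-monoʳ-≤ (length c) (m≤n+m _ (length b))) (cliff⇒from dd) wd)
          (between (m≤n+m _ (length d))
                   (+-monoʳ-≤ (length d) (+-monoʳ-≤ (length c) (m≤n+m _ (length b))))
                   ace-e we)))))

module CliffOperad (K : HeytingField r ℓ₁ ℓ₂) (δ : RangeMap) (unimodal : Unimodal δ) where

  open Offset δ

  R = fieldRing K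
  open CommutativeRing R
    using (Carrier; _≈_; 0#; 1#)
    renaming (_+_ to _+ᴷ_; _*_ to _*ᴷ_)
  private module R = CommutativeRing R

  -- There are finitely many cliffs of each size, so the free module on them
  -- consists of all families of coefficients.
  Comb : ℕ → Set r
  Comb n = Cliff δ n → Carrier

  combs : ℕ → Module R r ℓ₁
  combs n = record
    { Carrierᴹ = Comb n
    ; _≈ᴹ_ = G._≈_ ; _+ᴹ_ = G._∙_ ; 0ᴹ = G.ε ; -ᴹ_ = G._⁻¹
    ; isModule = IsModuleFromLeft.isModule {commutativeRing = R} record
      { isLeftModule = record
        { isLeftSemimodule = record
          { +ᴹ-isCommutativeMonoid = G.isCommutativeMonoid
          ; isPreleftSemimodule = record
            { *ₗ-cong      = λ a≈b f≈g c → R.*-cong a≈b (f≈g c)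
            ; *ₗ-zeroˡ     = λ f c → R.zeroˡ (f c)
            ; *ₗ-distribʳ  = λ f a b c → R.distribʳ (f c) a b
            ; *ₗ-identityˡ = λ f c → R.*-identityˡ (f c)
            ; *ₗ-assoc     = λ a b f c → R.*-assoc a b (f c)
            ; *ₗ-zeroʳ     = λ a c → R.zeroʳ a
            ; *ₗ-distribˡ  = λ a f g c → R.distribˡ a (f c) (g c)
            }
          }
        ; -ᴹ‿cong    = G.⁻¹-cong
        ; -ᴹ‿inverse = G.inverse
        }
      }
    }
    where
    module G = AbelianGroup (Pointwise.abelianGroup (Cliff δ n) R.+-abelianGroup)
    _*ₗ_ : Carrier → Comb n → Comb n
    (a *ₗ f) c = a *ᴷ f c

  module _ {n : ℕ} where
    open Module (combs n) public using (_≈ᴹ_; 0ᴹ)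

  E : ∀ {n} → Cliff δ n → Comb n
  E c d with ≡-dec _≟_ (word c) (word d)
  ... | yes _ = 1#
  ... | no  _ = 0#

  coeff : ∀ {n} → Comb n → Word → Carrier
  coeff {n} f w with isCliff? w | length w ≟ n
  ... | yes p | yes q = f (mkCliff w p q)
  ... | yes _ | no  _ = 0#
  ... | no  _ | _     = 0#

  -- A word w is u □⟨ i ⟩ v for exactly one pair (u , v) of words with v of
  -- length n, so the coefficient of w is a sum with at most one term.
  infixl 8 _∘⟨_⟩_
  _∘⟨_⟩_ : ∀ {m n} → Comb m → Fin (suc m) → Comb n → Comb (m + n)
  _∘⟨_⟩_ {n = n} f i g w =
    coeff f (outer (toℕ i) n (word w)) *ᴷ coeff g (inner (toℕ i) n (word w))

  ε-cliff : Cliff δ 0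
  ε-cliff = mkCliff [] (λ ()) refl

  open SetoidReasoning R.setoid

  coeff-yes : ∀ {n} (f : Comb n) w (p : IsCliff δ w) (q : length w ≡ n) →
              coeff f w ≡ f (mkCliff w p q)
  coeff-yes {n} f w p q with isCliff? w | length w ≟ n
  ... | yes _ | yes _ = refl
  ... | yes _ | no ¬q = contradiction q ¬q
  ... | no ¬p | _     = contradiction p ¬p

  coeff-no : ∀ {n} (f : Comb n) w → ¬ IsCliff δ w → coeff f w ≡ 0#
  coeff-no {n} f w ¬p with isCliff? w | length w ≟ n
  ... | yes p | _ = contradiction p ¬p
  ... | no _  | _ = refl

  coeff-word : ∀ {n} (f : Comb n) c → coeff f (word c) ≡ f c
  coeff-word f c = coeff-yes f (word c) (cliffWord c) (cliffLength c)

  coeff-length : ∀ {n} (f : Comb n) w → length w ≢ n → coeff f w ≡ 0#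
  coeff-length {n} f w ¬q with isCliff? w | length w ≟ n
  ... | no _  | _     = refl
  ... | yes _ | no _  = refl
  ... | yes _ | yes q = contradiction q ¬q

  coeff-0 : ∀ {n} w → coeff {n} 0ᴹ w ≈ 0#
  coeff-0 {n} w with isCliff? w | length w ≟ n
  ... | no _  | _     = R.refl
  ... | yes _ | no _  = R.refl
  ... | yes _ | yes _ = R.refl

  coeff-subst : ∀ {a b} (eq : a ≡ b) (f : Comb a) w → coeff (subst Comb eq f) w ≡ coeff f w
  coeff-subst refl f w = refl

  coeff-map₂ : ∀ {n} (_∙_ : Carrier → Carrier → Carrier) → 0# ≈ 0# ∙ 0# →
               ∀ (f g : Comb n) w → coeff (λ c → f c ∙ g c) w ≈ coeff f w ∙ coeff g w
  coeff-map₂ {n} _∙_ z f g w with isCliff? w | length w ≟ n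
  ... | yes _ | yes _ = R.refl
  ... | yes _ | no  _ = z
  ... | no _  | _     = z

  coeff-+ : ∀ {n} (f g : Comb n) w → coeff (λ c → f c +ᴷ g c) w ≈ coeff f w +ᴷ coeff g w
  coeff-+ = coeff-map₂ _+ᴷ_ (R.sym (R.+-identityˡ 0#))

  coeff-* : ∀ {n} a (f : Comb n) w → coeff (λ c → a *ᴷ f c) w ≈ a *ᴷ coeff f w
  coeff-* a f w = coeff-map₂ (λ x _ → a *ᴷ x) (R.sym (R.zeroʳ a)) f f w

  coeff-cong : ∀ {n} {f g : Comb n} → f ≈ᴹ g → ∀ w → coeff f w ≈ coeff g w
  coeff-cong {n} f≈g w with isCliff? w | length w ≟ n
  ... | yes p | yes q = f≈g _
  ... | yes _ | no  _ = R.refl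
  ... | no _  | _     = R.refl

  ext : ∀ {n} {f g : Comb n} →
        (∀ w → IsCliff δ w → length w ≡ n → coeff f w ≈ coeff g w) → f ≈ᴹ g
  ext {f = f} {g} h c = begin
    f c              ≡⟨ coeff-word f c ⟨
    coeff f (word c) ≈⟨ h (word c) (cliffWord c) (cliffLength c) ⟩
    coeff g (word c) ≡⟨ coeff-word g c ⟩
    g c              ∎

  module _ {l n} (f : Comb l) (i : Fin (suc l)) (g : Comb n) where

    coeff-∘ : ∀ a v b → length a ≡ toℕ i → length v ≡ n → length (a ++ b) ≡ l →
              (IsCliff δ (a ++ b) → IsCliff δ v → IsCliff δ (a ++ v ++ b)) →
              coeff (f ∘⟨ i ⟩ g) (a ++ v ++ b) ≈ coeff f (a ++ b) *ᴷ coeff g v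
    coeff-∘ a v b eqi eqn eql closed = by (isCliff? w)
      where
      w = a ++ v ++ b
      len : length w ≡ l + n
      len = ≡.trans (length-++₃ a v b) (cong₂ _+_ eql eqn)
      vanish : ¬ IsCliff δ w → Dec (IsCliff δ (a ++ b)) → Dec (IsCliff δ v) →
               coeff f (a ++ b) *ᴷ coeff g v ≈ 0#
      vanish ¬p (no ¬q) _       = R.trans (R.*-congʳ (R.reflexive (coeff-no f (a ++ b) ¬q))) (R.zeroˡ _)
      vanish ¬p (yes _) (no ¬s) = R.trans (R.*-congˡ (R.reflexive (coeff-no g v ¬s))) (R.zeroʳ _)
      vanish ¬p (yes q) (yes s) = contradiction (closed q s) ¬p
      by : Dec (IsCliff δ w) → coeff (f ∘⟨ i ⟩ g) w ≈ coeff f (a ++ b) *ᴷ coeff g v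
      by (yes p) = begin
        coeff (f ∘⟨ i ⟩ g) w                       ≡⟨ coeff-yes (f ∘⟨ i ⟩ g) w p len ⟩
        coeff f (outer (toℕ i) n w) *ᴷ coeff g (inner (toℕ i) n w)
          ≡⟨ cong₂ (λ s t → coeff f s *ᴷ coeff g t)
               (≡.trans (cong₂ (λ s t → outer s t w) (≡.sym eqi) (≡.sym eqn)) (outer-++ a v b))
               (≡.trans (cong₂ (λ s t → inner s t w) (≡.sym eqi) (≡.sym eqn)) (inner-++ a v b)) ⟩
        coeff f (a ++ b) *ᴷ coeff g v ∎
      by (no ¬p) = begin
        coeff (f ∘⟨ i ⟩ g) w          ≡⟨ coeff-no (f ∘⟨ i ⟩ g) w ¬p ⟩
        0#                            ≈⟨ vanish ¬p (isCliff? (a ++ b)) (isCliff? v) ⟨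
        coeff f (a ++ b) *ᴷ coeff g v ∎

  coeff-E-same : ∀ {n} (c : Cliff δ n) → coeff (E c) (word c) ≈ 1#
  coeff-E-same c = R.trans (R.reflexive (coeff-word (E c) c)) E-cc
    where
    E-cc : E c c ≈ 1#
    E-cc with ≡-dec _≟_ (word c) (word c)
    ... | yes _ = R.refl
    ... | no ¬p = contradiction refl ¬p

  coeff-E-other : ∀ {n} (c : Cliff δ n) {w} → word c ≢ w → coeff (E c) w ≈ 0#
  coeff-E-other {n} c {w} c≢w with isCliff? w | length w ≟ n
  ... | no _  | _     = R.refl
  ... | yes _ | no _  = R.refl
  ... | yes p | yes q with ≡-dec _≟_ (word c) w
  ...   | yes eq = contradiction eq c≢w
  ...   | no _   = R.refl

  -- These two laws determine the bilinear maps _∘⟨_⟩_; i and i′ are one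
  -- position, since length (word u) ≡ m.
  module _ {m n} (u : Cliff δ m) (i : Fin (suc (length (word u)))) (v : Cliff δ n)
           (i′ : Fin (suc m)) (i≡i′ : toℕ i ≡ toℕ i′) where

    private
      at : ∀ (d : Cliff δ (m + n)) →
           (word d ≡ word u □⟨ i ⟩ word v → (E u ∘⟨ i′ ⟩ E v) d ≈ 1#) ×
           (word d ≢ word u □⟨ i ⟩ word v → (E u ∘⟨ i′ ⟩ E v) d ≈ 0#)
      at d with decompose₁ (toℕ i′) m n (word d) (toℕ≤pred[n] i′) (cliffLength d)
      ... | a , y , b , eqd , eqa , eqy , eqab = same , other
        where
        value : (E u ∘⟨ i′ ⟩ E v) d ≈ coeff (E u) (a ++ b) *ᴷ coeff (E v) y
        value = begin
          (E u ∘⟨ i′ ⟩ E v) d                    ≡⟨ coeff-word (E u ∘⟨ i′ ⟩ E v) d ⟨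
          coeff (E u ∘⟨ i′ ⟩ E v) (word d)       ≡⟨ cong (coeff (E u ∘⟨ i′ ⟩ E v)) eqd ⟩
          coeff (E u ∘⟨ i′ ⟩ E v) (a ++ y ++ b)
            ≈⟨ coeff-∘ (E u) i′ (E v) a y b eqa eqy eqab
                 (λ _ _ → subst (IsCliff δ) eqd (cliffWord d)) ⟩
          coeff (E u) (a ++ b) *ᴷ coeff (E v) y  ∎

        same : word d ≡ word u □⟨ i ⟩ word v → (E u ∘⟨ i′ ⟩ E v) d ≈ 1#
        same eq = begin
          (E u ∘⟨ i′ ⟩ E v) d                                 ≈⟨ value ⟩
          coeff (E u) (a ++ b) *ᴷ coeff (E v) y
            ≡⟨ cong₂ (λ s t → coeff (E u) s *ᴷ coeff (E v) t) ab≡u y≡v ⟩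
          coeff (E u) (word u) *ᴷ coeff (E v) (word v)
            ≈⟨ R.*-cong (coeff-E-same u) (coeff-E-same v) ⟩
          1# *ᴷ 1#                                            ≈⟨ R.*-identityˡ 1# ⟩
          1#                                                  ∎
          where
          i≤ : toℕ i ≤ length (word u)
          i≤ = toℕ≤pred[n] i
          |a|≡i : length a ≡ toℕ i
          |a|≡i = ≡.trans eqa (≡.sym i≡i′)
          |y|≡v : length y ≡ length (word v)
          |y|≡v = ≡.trans eqy (≡.sym (cliffLength v))
          ab≡u : a ++ b ≡ word u
          ab≡u = ≡.trans (≡.sym (outer-++ a y b)) (≡.trans
            (≡.trans (cong₂ (λ s t → outer s t (a ++ y ++ b)) |a|≡i |y|≡v)
                     (cong (outer (toℕ i) (length (word v))) (≡.trans (≡.sym eqd) eq)))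
            (outer-□ (word u) i (word v)))
          y≡v : y ≡ word v
          y≡v = ≡.trans (≡.sym (inner-++ a y b)) (≡.trans
            (≡.trans (cong₂ (λ s t → inner s t (a ++ y ++ b)) |a|≡i |y|≡v)
                     (cong (inner (toℕ i) (length (word v))) (≡.trans (≡.sym eqd) eq)))
            (inner-□ (word u) i (word v)))

        other : word d ≢ word u □⟨ i ⟩ word v → (E u ∘⟨ i′ ⟩ E v) d ≈ 0#
        other neq = R.trans value (by (≡-dec _≟_ (word u) (a ++ b)) (≡-dec _≟_ (word v) y))
          where
          by : Dec (word u ≡ a ++ b) → Dec (word v ≡ y) →
               coeff (E u) (a ++ b) *ᴷ coeff (E v) y ≈ 0#
          by (no u≢) _ = R.trans (R.*-congʳ (coeff-E-other u u≢)) (R.zeroˡ _)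
          by (yes _) (no v≢) = R.trans (R.*-congˡ (coeff-E-other v v≢)) (R.zeroʳ _)
          by (yes u≡) (yes v≡) = contradiction
            (≡.trans eqd (≡.sym (≡.trans
              (cong₂ (λ s t → take (toℕ i) s ++ t ++ drop (toℕ i) s) u≡ v≡)
              (≡.trans (cong (λ k → take k (a ++ b) ++ y ++ drop k (a ++ b))
                         (≡.trans i≡i′ (≡.sym eqa)))
                (cong₂ (λ s t → s ++ y ++ t) (take-length a b) (drop-length a b)))))) neq

    E-∘-cliff : (w : Cliff δ (m + n)) → word w ≡ word u □⟨ i ⟩ word v →
                (E u ∘⟨ i′ ⟩ E v) ≈ᴹ E w
    E-∘-cliff w eq d with ≡-dec _≟_ (word w) (word d)
    ... | yes w≡d = proj₁ (at d) (≡.trans (≡.sym w≡d) eq)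
    ... | no w≢d  = proj₂ (at d) (λ d≡ → w≢d (≡.trans eq (≡.sym d≡)))

    E-∘-nocliff : ¬ IsCliff δ (word u □⟨ i ⟩ word v) → (E u ∘⟨ i′ ⟩ E v) ≈ᴹ 0ᴹ
    E-∘-nocliff ¬p d = proj₂ (at d) (λ d≡ → ¬p (subst (IsCliff δ) d≡ (cliffWord d)))

  open Closed unimodal

  Cl : NSOperad R r ℓ₁
  Cl = record
    { Op = combs
    ; _∘⟨_⟩_ = _∘⟨_⟩_
    ; id = E ε-cliff
    ; ∘-cong = λ i x≈ y≈ c → R.*-cong (coeff-cong x≈ (out i c)) (coeff-cong y≈ (inn i c))
    ; ∘-+ˡ = λ x x′ i y c → R.trans (R.*-congʳ (coeff-+ x x′ (out i c))) (R.distribʳ _ _ _)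
    ; ∘-+ʳ = λ x i y y′ c → R.trans (R.*-congˡ (coeff-+ y y′ (inn i c))) (R.distribˡ _ _ _)
    ; ∘-*ˡ = λ a x i y c → R.trans (R.*-congʳ (coeff-* a x (out i c))) (R.*-assoc a _ _)
    ; ∘-*ʳ = λ a x i y c → R.trans (R.*-congˡ (coeff-* a y (inn i c))) (x∙yz≈y∙xz _ a _)
    ; identityˡ = idˡ
    ; identityʳ = idʳ
    ; sequential = seq
    ; parallel = par
    }
    where
    open CommutativeSemigroupProperties R.*-commutativeSemigroup using (x∙yz≈y∙xz)

    out inn : ∀ {m n} → Fin (suc m) → Cliff δ (m + n) → Word
    out {n = n} i c = outer (toℕ i) n (word c)
    inn {n = n} i c = inner (toℕ i) n (word c)

    idˡ : ∀ {n} (x : Comb n) → (E ε-cliff ∘⟨ Fin.zero ⟩ x) ≈ᴹ x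
    idˡ {n} x = ext λ w p len → begin
      coeff (E ε-cliff ∘⟨ Fin.zero ⟩ x) w
        ≡⟨ cong (coeff (E ε-cliff ∘⟨ Fin.zero ⟩ x)) (++-identityʳ w) ⟨
      coeff (E ε-cliff ∘⟨ Fin.zero ⟩ x) (w ++ [])
        ≈⟨ coeff-∘ (E ε-cliff) Fin.zero x [] w [] refl len refl
             (λ _ _ → subst (IsCliff δ) (≡.sym (++-identityʳ w)) p) ⟩
      coeff (E ε-cliff) [] *ᴷ coeff x w ≈⟨ R.*-congʳ (coeff-E-same ε-cliff) ⟩
      1# *ᴷ coeff x w                   ≈⟨ R.*-identityˡ _ ⟩
      coeff x w                         ∎

    idʳ : ∀ {n} (x : Comb n) i → subst Comb (+-identityʳ n) (x ∘⟨ i ⟩ E ε-cliff) ≈ᴹ x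
    idʳ {n} x i = ext λ w p len → at w p len (cut (toℕ i) w
                    (subst (toℕ i ≤_) (≡.sym len) (toℕ≤pred[n] i)))
      where
      at : ∀ w → IsCliff δ w → length w ≡ n → (∃₂ λ a b → w ≡ a ++ b × length a ≡ toℕ i) →
           coeff (subst Comb (+-identityʳ n) (x ∘⟨ i ⟩ E ε-cliff)) w ≈ coeff x w
      at _ p len (a , b , refl , eqa) = begin
        coeff (subst Comb (+-identityʳ n) (x ∘⟨ i ⟩ E ε-cliff)) (a ++ b)
          ≡⟨ coeff-subst (+-identityʳ n) (x ∘⟨ i ⟩ E ε-cliff) (a ++ b) ⟩
        coeff (x ∘⟨ i ⟩ E ε-cliff) (a ++ b)
          ≈⟨ coeff-∘ x i (E ε-cliff) a [] b eqa refl len (λ q _ → q) ⟩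
        coeff x (a ++ b) *ᴷ coeff (E ε-cliff) [] ≈⟨ R.*-congˡ (coeff-E-same ε-cliff) ⟩
        coeff x (a ++ b) *ᴷ 1#                   ≈⟨ R.*-identityʳ _ ⟩
        coeff x (a ++ b)                         ∎

    seq : ∀ {l m n} (x : Comb l) (y : Comb m) (z : Comb n)
          (i : Fin (suc l)) (j : Fin (suc m)) (k : Fin (suc (l + m))) →
          toℕ k ≡ toℕ i + toℕ j →
          subst Comb (+-assoc l m n) ((x ∘⟨ i ⟩ y) ∘⟨ k ⟩ z) ≈ᴹ (x ∘⟨ i ⟩ (y ∘⟨ j ⟩ z))
    seq {l} {m} {n} x y z i j k k≡ = ext λ w p len → at w p
        (decompose-seq (toℕ i) (toℕ j) l m n w (toℕ≤pred[n] i) (toℕ≤pred[n] j) len)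
      where
      at : ∀ w → IsCliff δ w → SeqDecomposition (toℕ i) (toℕ j) l m n w →
           coeff (subst Comb (+-assoc l m n) ((x ∘⟨ i ⟩ y) ∘⟨ k ⟩ z)) w
             ≈ coeff (x ∘⟨ i ⟩ (y ∘⟨ j ⟩ z)) w
      at _ p (a , b , c , d , e , refl , eqa , eqb , eqc , eqbd , eqae) = begin
        coeff (subst Comb (+-assoc l m n) ((x ∘⟨ i ⟩ y) ∘⟨ k ⟩ z)) (a ++ (b ++ c ++ d) ++ e)
          ≡⟨ coeff-subst (+-assoc l m n) ((x ∘⟨ i ⟩ y) ∘⟨ k ⟩ z) (a ++ (b ++ c ++ d) ++ e) ⟩
        coeff ((x ∘⟨ i ⟩ y) ∘⟨ k ⟩ z) (a ++ (b ++ c ++ d) ++ e)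
          ≡⟨ cong (coeff ((x ∘⟨ i ⟩ y) ∘⟨ k ⟩ z)) w≡ ⟩
        coeff ((x ∘⟨ i ⟩ y) ∘⟨ k ⟩ z) ((a ++ b) ++ c ++ (d ++ e))
          ≈⟨ coeff-∘ (x ∘⟨ i ⟩ y) k z (a ++ b) c (d ++ e)
               (≡.trans (length-++ a) (≡.trans (cong₂ _+_ eqa eqb) (≡.sym k≡))) eqc
               (≡.trans (cong length u≡) (≡.trans (length-++₃ a (b ++ d) e)
                 (cong₂ _+_ eqae eqbd)))
               (λ _ _ → subst (IsCliff δ) w≡ p) ⟩
        coeff (x ∘⟨ i ⟩ y) ((a ++ b) ++ (d ++ e)) *ᴷ coeff z c
          ≡⟨ cong (λ s → coeff (x ∘⟨ i ⟩ y) s *ᴷ coeff z c) u≡ ⟩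
        coeff (x ∘⟨ i ⟩ y) (a ++ (b ++ d) ++ e) *ᴷ coeff z c
          ≈⟨ R.*-congʳ (coeff-∘ x i y a (b ++ d) e eqa eqbd eqae (seq-closed₁ a b c d e p)) ⟩
        (coeff x (a ++ e) *ᴷ coeff y (b ++ d)) *ᴷ coeff z c
          ≈⟨ R.*-assoc _ _ _ ⟩
        coeff x (a ++ e) *ᴷ (coeff y (b ++ d) *ᴷ coeff z c)
          ≈⟨ R.*-congˡ (coeff-∘ y j z b c d eqb eqc eqbd (seq-closed₂ a b c d e p)) ⟨
        coeff x (a ++ e) *ᴷ coeff (y ∘⟨ j ⟩ z) (b ++ c ++ d)
          ≈⟨ coeff-∘ x i (y ∘⟨ j ⟩ z) a (b ++ c ++ d) e eqa
               (≡.trans (length-++₃ b c d) (cong₂ _+_ eqbd eqc)) eqae (λ _ _ → p) ⟨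
        coeff (x ∘⟨ i ⟩ (y ∘⟨ j ⟩ z)) (a ++ (b ++ c ++ d) ++ e) ∎
        where
        w≡ : a ++ (b ++ c ++ d) ++ e ≡ (a ++ b) ++ c ++ (d ++ e)
        w≡ rewrite ++-assoc a b (c ++ d ++ e) | ++-assoc b (c ++ d) e | ++-assoc c d e = refl
        u≡ : (a ++ b) ++ (d ++ e) ≡ a ++ (b ++ d) ++ e
        u≡ rewrite ++-assoc a b (d ++ e) | ++-assoc b d e = refl

    par : ∀ {l m n} (x : Comb l) (y : Comb m) (z : Comb n)
          (i j : Fin (suc l)) (k : Fin (suc (l + m))) (i′ : Fin (suc (l + n))) →
          toℕ i < toℕ j → toℕ k ≡ toℕ j + m → toℕ i′ ≡ toℕ i →
          subst Comb (+-swapʳ l m n) ((x ∘⟨ i ⟩ y) ∘⟨ k ⟩ z) ≈ᴹ ((x ∘⟨ j ⟩ z) ∘⟨ i′ ⟩ y)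
    par {l} {m} {n} x y z i j k i′ i<j k≡ i′≡ = ext λ w p len → at w p
        (decompose-par (toℕ i) (toℕ j) l m n w (<⇒≤ i<j) (toℕ≤pred[n] j) len)
      where
      at : ∀ w → IsCliff δ w → ParDecomposition (toℕ i) (toℕ j) l m n w →
           coeff (subst Comb (+-swapʳ l m n) ((x ∘⟨ i ⟩ y) ∘⟨ k ⟩ z)) w
             ≈ coeff ((x ∘⟨ j ⟩ z) ∘⟨ i′ ⟩ y) w
      at _ p (a , b , c , d , e , refl , eqa , eqb , eqac , eqd , eqace) = begin
        coeff (subst Comb (+-swapʳ l m n) ((x ∘⟨ i ⟩ y) ∘⟨ k ⟩ z)) (a ++ b ++ c ++ d ++ e)
          ≡⟨ coeff-subst (+-swapʳ l m n) ((x ∘⟨ i ⟩ y) ∘⟨ k ⟩ z) (a ++ b ++ c ++ d ++ e) ⟩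
        coeff ((x ∘⟨ i ⟩ y) ∘⟨ k ⟩ z) (a ++ b ++ c ++ d ++ e)
          ≡⟨ cong (coeff ((x ∘⟨ i ⟩ y) ∘⟨ k ⟩ z)) w≡ ⟩
        coeff ((x ∘⟨ i ⟩ y) ∘⟨ k ⟩ z) ((a ++ b ++ c) ++ d ++ e)
          ≈⟨ coeff-∘ (x ∘⟨ i ⟩ y) k z (a ++ b ++ c) d e
               (≡.trans (length-++₃ a b c) (≡.trans (cong₂ _+_ eqac eqb) (≡.sym k≡))) eqd
               (≡.trans (cong length u≡) (≡.trans (length-++₃ a b (c ++ e))
                 (cong₂ _+_ eqace eqb)))
               (λ _ _ → subst (IsCliff δ) w≡ p) ⟩
        coeff (x ∘⟨ i ⟩ y) ((a ++ b ++ c) ++ e) *ᴷ coeff z d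
          ≡⟨ cong (λ s → coeff (x ∘⟨ i ⟩ y) s *ᴷ coeff z d) u≡ ⟩
        coeff (x ∘⟨ i ⟩ y) (a ++ b ++ (c ++ e)) *ᴷ coeff z d
          ≈⟨ R.*-congʳ (coeff-∘ x i y a b (c ++ e) eqa eqb eqace (par-closed₁ a b c d e p)) ⟩
        (coeff x (a ++ c ++ e) *ᴷ coeff y b) *ᴷ coeff z d
          ≈⟨ xy∙z≈xz∙y _ _ _ ⟩
        (coeff x (a ++ c ++ e) *ᴷ coeff z d) *ᴷ coeff y b
          ≡⟨ cong (λ s → (coeff x s *ᴷ coeff z d) *ᴷ coeff y b) (++-assoc a c e) ⟨
        (coeff x ((a ++ c) ++ e) *ᴷ coeff z d) *ᴷ coeff y b
          ≈⟨ R.*-congʳ (coeff-∘ x j z (a ++ c) d e eqac eqd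
               (≡.trans (cong length (++-assoc a c e)) eqace) (par-closed₂ a b c d e p)) ⟨
        coeff (x ∘⟨ j ⟩ z) ((a ++ c) ++ d ++ e) *ᴷ coeff y b
          ≡⟨ cong (λ s → coeff (x ∘⟨ j ⟩ z) s *ᴷ coeff y b) (++-assoc a c (d ++ e)) ⟩
        coeff (x ∘⟨ j ⟩ z) (a ++ (c ++ d ++ e)) *ᴷ coeff y b
          ≈⟨ coeff-∘ (x ∘⟨ j ⟩ z) i′ y a b (c ++ d ++ e) (≡.trans eqa (≡.sym i′≡)) eqb
               (≡.trans (cong length (≡.sym (++-assoc a c (d ++ e))))
                 (≡.trans (length-++₃ (a ++ c) d e)
                   (cong₂ _+_ (≡.trans (cong length (++-assoc a c e)) eqace) eqd)))
               (λ _ _ → p) ⟨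
        coeff ((x ∘⟨ j ⟩ z) ∘⟨ i′ ⟩ y) (a ++ b ++ c ++ d ++ e) ∎
        where
        open CommutativeSemigroupProperties R.*-commutativeSemigroup using (xy∙z≈xz∙y)
        w≡ : a ++ b ++ c ++ d ++ e ≡ (a ++ b ++ c) ++ d ++ e
        w≡ rewrite ++-assoc a (b ++ c) (d ++ e) | ++-assoc b c (d ++ e) = refl
        u≡ : (a ++ b ++ c) ++ e ≡ a ++ b ++ (c ++ e)
        u≡ rewrite ++-assoc a (b ++ c) e | ++-assoc b c e = refl

  primeSet : GradedSubset Cl ℓ₁
  primeSet = record
    { member   = λ {n} x → Σ (Cliff δ n) λ w → IsPrime δ (word w) × x ≈ᴹ E w
    ; respects = λ x≈y (w , pr , x≈E) → w , pr , λ c → R.trans (R.sym (x≈y c)) (x≈E c)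
    }

  E-generated : ∀ k w (p : IsCliff δ w) n (len : length w ≡ n) → n < k →
                Generated Cl primeSet (E (mkCliff w p len))
  E-generated (suc k) [] p _ refl _ = resp (λ _ → R.refl) unit
  E-generated (suc k) w@(_ ∷ _) p n len (s≤s n≤k) with prime⊎composite w p (λ ())
  ... | inj₁ prime = gen (mkCliff w p len , prime , λ _ → R.refl)
  ... | inj₂ (u , v , i , cu , cv , eq , u<w , v<w) = from-parts n len total
    where
    total : n ≡ length u + length v
    total = ≡.trans (≡.sym len) (≡.trans (cong length eq) (length-□ u i v))
    lt : ∀ {a} → a < length w → a < k
    lt a< = <-≤-trans a< (subst (_≤ k) (≡.sym len) n≤k)
    from-parts : ∀ n (len : length w ≡ n) → n ≡ length u + length v →
                 Generated Cl primeSet (E (mkCliff w p len))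
    from-parts _ len refl = resp
      (E-∘-cliff (mkCliff u cu refl) i (mkCliff v cv refl) i refl (mkCliff w p len) eq)
      (comp i (E-generated k u cu (length u) refl (lt u<w))
              (E-generated k v cv (length v) refl (lt v<w)))

  supported-generated : ∀ {n} ws (x : Comb n) → (∀ c → word c ∉ ws → x c ≈ 0#) →
                        Generated Cl primeSet x
  supported-generated [] x h = resp (λ c → R.sym (h c (λ ()))) zero
  supported-generated {n} (w ∷ ws) x h = by (isCliff? w) (length w ≟ n)
    where
    skip : (∀ c → word c ≢ w) → Generated Cl primeSet x
    skip never = supported-generated ws x λ c c∉ →
      h c λ { (here eq) → never c eq ; (there c∈) → c∉ c∈ }
    by : Dec (IsCliff δ w) → Dec (length w ≡ n) → Generated Cl primeSet x
    by (no ¬p) _ = skip λ c eq → ¬p (subst (IsCliff δ) eq (cliffWord c))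
    by (yes _) (no ¬q) = skip λ c eq → ¬q (subst (λ v → length v ≡ n) eq (cliffLength c))
    by (yes p) (yes q) = resp sum
        (add (scal (x W) (E-generated (suc n) w p n q ≤-refl))
             (supported-generated ws rest rest-supported))
      where
      W : Cliff δ n
      W = mkCliff w p q
      rest : Comb n
      rest c with ≡-dec _≟_ w (word c)
      ... | yes _ = 0#
      ... | no  _ = x c
      rest-supported : ∀ c → word c ∉ ws → rest c ≈ 0#
      rest-supported c c∉ with ≡-dec _≟_ w (word c)
      ... | yes _ = R.refl
      ... | no w≢ = h c λ { (here eq) → w≢ (≡.sym eq) ; (there c∈) → c∉ c∈ }
      sum : ∀ c → x W *ᴷ E W c +ᴷ rest c ≈ x c
      sum c with ≡-dec _≟_ w (word c)
      ... | yes refl = R.trans (R.+-identityʳ _) (R.*-identityʳ _)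
      ... | no _     = R.trans (R.+-congʳ (R.zeroʳ _)) (R.+-identityˡ _)

  primeSet-generates : Generates Cl primeSet
  primeSet-generates {n} x = supported-generated (words 0 n) x λ c c∉ →
    contradiction (subst (λ k → word c ∈ words 0 k) (cliffLength c)
                    (∈-words (cliff⇒from (cliffWord c)))) c∉

  1≉0 : ¬ 1# ≈ 0#
  1≉0 1≈0 = K.#-irrefl K.refl (K.invertible⇒# {0#} {0#} (0# , trivial , trivial))
    where
    module K = HeytingField K
    trivial : ∀ {x y} → x *ᴷ y ≈ 1#
    trivial {x} {y} = begin
      x *ᴷ y         ≈⟨ R.*-identityʳ _ ⟨
      x *ᴷ y *ᴷ 1#   ≈⟨ R.*-congˡ 1≈0 ⟩
      x *ᴷ y *ᴷ 0#   ≈⟨ R.zeroʳ _ ⟩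
      0#             ≈⟨ 1≈0 ⟨
      1#             ∎

  module _ (T : GradedSubset Cl ℓ₁) (T⊆ : _⊆ᴳ_ Cl T primeSet)
           {n₀} (W : Cliff δ n₀) (prime : IsPrime δ (word W)) where
    open GradedSubset T

    coeff-generated : ∀ {n} {x : Comb n} → Generated Cl T x →
                      coeff x (word W) ≈ 0# ⊎ member (E W)
    coeff-generated (gen {n} {x} x∈T) with T⊆ x x∈T
    ... | V , _ , x≈E = by (≡-dec _≟_ (word V) (word W))
      where
      by : Dec (word V ≡ word W) → _
      by (no V≢W)  = inj₁ (R.trans (coeff-cong x≈E (word W)) (coeff-E-other V V≢W))
      by (yes V≡W) = inj₂ (move V V≡W n≡n₀ (respects x≈E x∈T))
        where
        n≡n₀ : n ≡ n₀
        n≡n₀ = ≡.trans (≡.sym (cliffLength V)) (≡.trans (cong length V≡W) (cliffLength W))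
        move : ∀ {n} (V : Cliff δ n) → word V ≡ word W → n ≡ n₀ → member (E V) → member (E W)
        move (mkCliff _ _ _) refl refl E∈ = E∈
    coeff-generated unit = inj₁ (coeff-E-other ε-cliff (λ eq → IsPrime.nonempty prime (≡.sym eq)))
    coeff-generated (comp {m} {n} {x} {y} i gx gy) = by-length (length (word W) ≟ m + n)
      where
      by-length : Dec (length (word W) ≡ m + n) →
                  coeff (x ∘⟨ i ⟩ y) (word W) ≈ 0# ⊎ member (E W)
      by-length (no ¬len) = inj₁ (R.reflexive (coeff-length (x ∘⟨ i ⟩ y) (word W) ¬len))
      by-length (yes len) with decompose₁ (toℕ i) m n (word W) (toℕ≤pred[n] i) len
      ... | a , v , b , eqw , eqa , eqv , eqab =
        by (isCliff? (a ++ b)) (isCliff? v)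
        where
        value : coeff (x ∘⟨ i ⟩ y) (word W) ≈ coeff x (a ++ b) *ᴷ coeff y v
        value = R.trans (R.reflexive (cong (coeff (x ∘⟨ i ⟩ y)) eqw))
          (coeff-∘ x i y a v b eqa eqv eqab (λ _ _ → subst (IsCliff δ) eqw (cliffWord W)))
        zeroˡ : coeff x (a ++ b) ≈ 0# → coeff (x ∘⟨ i ⟩ y) (word W) ≈ 0#
        zeroˡ x≈0 = R.trans value (R.trans (R.*-congʳ x≈0) (R.zeroˡ _))
        zeroʳ : coeff y v ≈ 0# → coeff (x ∘⟨ i ⟩ y) (word W) ≈ 0#
        zeroʳ y≈0 = R.trans value (R.trans (R.*-congˡ y≈0) (R.zeroʳ _))
        i< : length a < suc (length (a ++ b))
        i< = s≤s (subst (length a ≤_) (≡.sym (length-++ a)) (m≤m+n _ _))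
        recombine : word W ≡ (a ++ b) □⟨ fromℕ< i< ⟩ v
        recombine = ≡.trans eqw (≡.sym (□-++ a v b (fromℕ< i<) (toℕ-fromℕ< i<)))
        by : Dec (IsCliff δ (a ++ b)) → Dec (IsCliff δ v) →
             coeff (x ∘⟨ i ⟩ y) (word W) ≈ 0# ⊎ member (E W)
        by (no ¬p) _ = inj₁ (zeroˡ (R.reflexive (coeff-no x (a ++ b) ¬p)))
        by (yes _) (no ¬q) = inj₁ (zeroʳ (R.reflexive (coeff-no y v ¬q)))
        by (yes p) (yes q)
          with IsPrime.indecomposable prime (a ++ b) v (fromℕ< i<) p q recombine
        ... | inj₁ (ab≡w , _) with coeff-generated gx
        ...   | inj₁ x≈0 = inj₁ (zeroˡ (subst (λ s → coeff x s ≈ 0#) (≡.sym ab≡w) x≈0))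
        ...   | inj₂ E∈  = inj₂ E∈
        by (yes p) (yes q) | inj₂ (_ , v≡w) with coeff-generated gy
        ...   | inj₁ y≈0 = inj₁ (zeroʳ (subst (λ s → coeff y s ≈ 0#) (≡.sym v≡w) y≈0))
        ...   | inj₂ E∈  = inj₂ E∈
    coeff-generated (zero {n}) = inj₁ (coeff-0 {n} (word W))
    coeff-generated (add {x = x} {y} gx gy) with coeff-generated gx | coeff-generated gy
    ... | inj₂ E∈  | _        = inj₂ E∈
    ... | inj₁ _   | inj₂ E∈  = inj₂ E∈
    ... | inj₁ x≈0 | inj₁ y≈0 = inj₁ (R.trans (coeff-+ x y (word W))
                                  (R.trans (R.+-cong x≈0 y≈0) (R.+-identityˡ 0#)))
    coeff-generated (scal a {x} gx) with coeff-generated gx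
    ... | inj₂ E∈  = inj₂ E∈
    ... | inj₁ x≈0 = inj₁ (R.trans (coeff-* a x (word W))
                       (R.trans (R.*-congˡ x≈0) (R.zeroʳ a)))
    coeff-generated (resp x≈y gx) with coeff-generated gx
    ... | inj₂ E∈  = inj₂ E∈
    ... | inj₁ x≈0 = inj₁ (R.trans (R.sym (coeff-cong x≈y (word W))) x≈0)

  𝔊 : MinimalGeneratingSet Cl ℓ₁
  𝔊 = record
    { generators = primeSet
    ; generates  = primeSet-generates
    ; minimal    = minimal
    }
    where
    minimal : (T : GradedSubset Cl ℓ₁) → _⊆ᴳ_ Cl T primeSet → Generates Cl T →
              _⊆ᴳ_ Cl primeSet T
    minimal T T⊆ T-generates x (W , prime , x≈E) with coeff-generated T T⊆ W prime (T-generates (E W))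
    ... | inj₁ E≈0 = contradiction (R.trans (R.sym (coeff-E-same W)) E≈0) 1≉0
    ... | inj₂ E∈  = GradedSubset.respects T (λ c → R.sym (x≈E c)) E∈

open CliffOperad public using (Cl; 𝔊)

{-# OPTIONS --safe #-}

-- The theorem amounts to a bound on the length of the prime cliffs.
-- If δ(1) ≥ δ(k′) for all k′ ≥ k, then the last letter of a cliff of length
-- n > k is itself a cliff of length 1, so that the word splits. Conversely, if
-- δ(n) > δ(1) and m is least with δ(m) > δ(1), unimodality makes
-- 0^(m − 1) (δ(1) + 1)^(n − m + 1) a cliff. It is prime: a cliff with a letter
-- above δ(1) has at least m − 1 letters at most δ(1), so only one of the two
-- factors of a splitting can have letters above δ(1), and it takes all the
-- letters at most δ(1) as well.
module Submission where

open import Level using (Level)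
open import Algebra.Apartness.Bundles using (HeytingField)
open import Function.Bundles using (_⇔_)
open import Defs

open import Algebra.Bundles using (CommutativeRing)
open import Data.Fin.Base using (fromℕ<)
open import Data.Fin.Properties using (toℕ-fromℕ<)
open import Data.List.Base
  using (List; []; _∷_; _++_; length; replicate; filter; map; concatMap; upTo;
         InitLast; initLast; _∷ʳ′_)
open import Data.List.Extrema.Nat using (max; xs≤max)
open import Data.List.Membership.Propositional using (lose)
open import Data.List.Membership.Propositional.Properties using (∈-concatMap⁺; ∈-upTo⁺)
open import Data.List.Properties
  using (filter-accept; filter-all; filter-none; filter-++; length-++; length-replicate; ++-identityʳ)
import Data.List.Relation.Unary.All as All
import Data.List.Relation.Unary.All.Properties as All
open import Data.List.Relation.Unary.Any as Any using (Any; here)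
open import Data.List.Relation.Unary.Any.Properties using (concatMap⁺; concatMap⁻; map⁺)
open import Data.Nat.Base
open import Data.Nat.Properties
open import Data.Product.Base using (∃; ∃-syntax; _×_; _,_; proj₁)
open import Data.Sum.Base using (_⊎_; inj₁; inj₂)
open import Function.Base using (_∘_)
open import Function.Bundles using (mk⇔; Equivalence)
open import Relation.Binary.PropositionalEquality
open import Relation.Nullary using (¬_; Dec; yes; no; contradiction)
open import Relation.Unary using (Pred; Decidable)

least : ∀ {p} {P : Pred ℕ p} → Decidable P → ∀ n → P n →
        ∃[ m ] (m ≤ n × P m × (∀ j → j < m → ¬ P j))
least P? zero    p = 0 , z≤n , p , λ _ ()
least P? (suc n) p with P? 0
... | yes p₀ = 0 , z≤n , p₀ , λ _ ()
... | no ¬p₀ with least (P? ∘ suc) n p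
...   | m , m≤n , pm , below = suc m , s≤s m≤n , pm , λ
  { zero    _         → ¬p₀
  ; (suc j) (s≤s j<m) → below j j<m }

-- Splittings of words and decidability of primality.

module _ (δ : RangeMap) where
  open Offset δ

  PrimesBoundedBy : ℕ → Set
  PrimesBoundedBy N = ∀ w → IsPrime δ w → length w ≤ N

  ++-indecomposable : ∀ {w} → IsPrime δ w → ∀ a v b → IsCliff δ (a ++ b) → IsCliff δ v →
    w ≡ a ++ v ++ b → (a ++ b ≡ w × v ≡ []) ⊎ (a ++ b ≡ [] × v ≡ w)
  ++-indecomposable prime a v b cab cv eq =
    IsPrime.indecomposable prime (a ++ b) v (fromℕ< i<) cab cv
      (trans eq (sym (□-++ a v b (fromℕ< i<) (toℕ-fromℕ< i<))))
    where
    i< : length a < size (a ++ b)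
    i< = s≤s (subst (length a ≤_) (sym (length-++ a)) (m≤m+n _ _))

  -- Needed to pick the primes out of a finite list of words. A splitting into two strictly shorter
  -- cliffs leaves neither factor equal to `w`.
  prime? : ∀ w → Dec (IsPrime δ w)
  prime? [] = no λ prime → IsPrime.nonempty prime refl
  prime? w@(_ ∷ _) with isCliff? w
  ... | no ¬cl = no (¬cl ∘ IsPrime.isCliff)
  ... | yes cl with prime⊎composite w cl (λ ())
  ...   | inj₁ prime = yes prime
  ...   | inj₂ (u , v , i , cu , cv , eq , u<w , v<w) = no composite
    where
    composite : ¬ IsPrime δ w
    composite prime with IsPrime.indecomposable prime u v i cu cv eq
    ... | inj₁ (u≡w , _) = <⇒≢ u<w (cong length u≡w)
    ... | inj₂ (_ , v≡w) = <⇒≢ v<w (cong length v≡w)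

  -- From domination to a length bound on primes.

  dominated⇒bounded : OneDominated δ → ∃ PrimesBoundedBy
  dominated⇒bounded (k , k≥1 , dom) = k , λ w prime → by w prime (initLast w)
    where
    by : ∀ w → IsPrime δ w → InitLast w → length w ≤ k
    by _ prime []       = contradiction refl (IsPrime.nonempty prime)
    by _ prime (u ∷ʳ′ x) = ≮⇒≥ λ k<w →
      split (subst (k <_) (trans (length-++ u) (+-comm (length u) 1)) k<w)
      where
      split : ¬ k < suc (length u)
      split k<1+u with unglue u (cliff⇒from (IsPrime.isCliff prime))
      ... | fu , (x≤ ∷ []) with ++-indecomposable prime u (x ∷ []) []
            (subst (IsCliff δ) (sym (++-identityʳ u)) (from⇒cliff fu))
            -- The last letter stands at position `length u + 1`, beyond `k`, so `dom` applies to
            -- its bound.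
            (from⇒cliff (≤-trans x≤ (dom _ (<⇒≤ (subst (λ l → k < suc l)
              (sym (+-identityʳ (length u))) k<1+u))) ∷ []))
            refl
      ...   | inj₁ (_ , ())
      -- One-letter cliffs are prime; `k≥1` keeps them within the bound.
      ...   | inj₂ (u≡[] , _) = <⇒≱ k<1+u (subst (λ u → suc (length u) ≤ k)
              (trans (sym u≡[]) (++-identityʳ u)) k≥1)

  -- Long primes from an ascent of the range map.

  from-replicate : ∀ {o x} n → (∀ j → o ≤ j → j < o + n → x ≤ δ⁺ j) → From o (replicate n x)
  from-replicate zero    h = []
  from-replicate {o} (suc n) h = h o ≤-refl (m<m+n o z<s) ∷ from-replicate n λ j o<j j< →
    h j (<⇒≤ o<j) (subst (j <_) (sym (+-suc o n)) j<)

  module _ (d : ℕ) where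

    low : Word → ℕ
    low w = length (filter (_≤? d) w)

    low-++₃ : ∀ a v b → low (a ++ v ++ b) ≡ low (a ++ b) + low v
    low-++₃ a v b
      rewrite filter-++ (_≤? d) a (v ++ b) | filter-++ (_≤? d) v b | filter-++ (_≤? d) a b =
      length-++₃ (filter (_≤? d) a) (filter (_≤? d) v) (filter (_≤? d) b)

    -- A letter above `d` can only stand at an index `p` or later, so at least `p - o` low letters
    -- come before the first one. In the induction each low letter moves the offset by one, which
    -- leaves `low w + o` unchanged.
    few-low⇒all-low : ∀ {p o w} → (∀ j → j < p → δ⁺ j ≤ d) → From o w → low w + o < p →
                      low w ≡ length w
    few-low⇒all-low h [] _ = refl
    few-low⇒all-low {p} {o} {x ∷ w} h (x≤ ∷ fw) lt =
      trans low-∷ (cong suc (few-low⇒all-low h fw (subst (_< p)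
        (trans (cong (_+ o) low-∷) (sym (+-suc (low w) o))) lt)))
      where
      low-∷ : low (x ∷ w) ≡ suc (low w)
      low-∷ = cong length (filter-accept (_≤? d) (≤-trans x≤ (h o (≤-<-trans (m≤n+m o _) lt))))

    -- The threshold of `few-low⇒all-low` is taken to be `low w`: a factor with fewer low letters
    -- than `w` is entirely low. Both factors cannot be, since `w` is not.
    low-cliff⇒prime : ∀ w → IsCliff δ w → 0 < low w → low w < length w →
                      (∀ j → j < low w → δ⁺ j ≤ d) → IsPrime δ w
    low-cliff⇒prime w cw 0<low low< h = record
      { nonempty = λ { refl → contradiction low< λ () } ; isCliff = cw ; indecomposable = indec }
      where
      all-low : ∀ u → IsCliff δ u → low u < low w → low u ≡ length u
      all-low u cu lt = few-low⇒all-low {w = u} h (cliff⇒from cu)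
        (subst (_< low w) (sym (+-identityʳ (low u))) lt)
      indec : ∀ u v i → IsCliff δ u → IsCliff δ v → w ≡ u □⟨ i ⟩ v →
              (u ≡ w × v ≡ []) ⊎ (u ≡ [] × v ≡ w)
      indec u v i cu cv eq with split-at u i
      ... | a , b , refl , |a|≡i with trans eq (□-++ a v b i (sym |a|≡i))
      ...   | w≡ = by (low (a ++ b) <? low w) (low v <? low w)
        where
        sum : low w ≡ low (a ++ b) + low v
        sum = trans (cong low w≡) (low-++₃ a v b)
        by : Dec (low (a ++ b) < low w) → Dec (low v < low w) →
             (a ++ b ≡ w × v ≡ []) ⊎ (a ++ b ≡ [] × v ≡ w)
        by (yes ab<) (yes v<) = contradiction
          (trans sum (trans (cong₂ _+_ (all-low (a ++ b) cu ab<) (all-low v cv v<))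
            (trans (sym (length-++₃ a v b)) (cong length (sym w≡)))))
          (<⇒≢ low<)
        -- All low letters lie in `a ++ b`. Then `v` has none, fewer than `w` by `0<low`, so `v` is
        -- entirely low and hence empty.
        by (no ab≮) _ = inj₁ (trans (cong (a ++_) (cong (_++ b) (sym v≡[]))) (sym w≡) , v≡[])
          where
          low-v : low v ≡ 0
          low-v = n≤0⇒n≡0 (+-cancelˡ-≤ (low w) _ 0 (≤-trans (+-monoˡ-≤ (low v) (≮⇒≥ ab≮))
            (≤-reflexive (trans (sym sum) (sym (+-identityʳ _))))))
          v≡[] : v ≡ []
          v≡[] = length≡0⇒[] (trans (sym (all-low v cv (subst (_< low w) (sym low-v) 0<low))) low-v)
        by (yes ab<) (no v≮) = inj₂ (ab≡[] , trans (sym (++-bare a v b ab≡[])) (sym w≡))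
          where
          low-ab : low (a ++ b) ≡ 0
          low-ab = n≤0⇒n≡0 (+-cancelʳ-≤ (low w) _ 0 (≤-trans (+-monoʳ-≤ (low (a ++ b)) (≮⇒≥ v≮))
            (≤-reflexive (sym sum))))
          ab≡[] : a ++ b ≡ []
          ab≡[] = length≡0⇒[] (trans (sym (all-low (a ++ b) cu ab<)) low-ab)

  ascent⇒prime : Unimodal δ → ∀ n → δ⁺ 0 < δ⁺ n → ∃[ w ] (IsPrime δ w × length w ≡ suc n)
  ascent⇒prime unimodal n 0<n with least (λ j → δ⁺ 0 <? δ⁺ j) n 0<n
  ... | zero , _ , d<d , _ = contradiction d<d (<-irrefl refl)
  -- Indices start at 0, so `p` is both the first index whose bound exceeds `d` and the number of
  -- zeros put before it. Thus `low d w` is exactly the threshold that `below` supports.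
  ... | p@(suc _) , p≤n , d<p , below =
    w , low-cliff⇒prime d w cw (subst (0 <_) (sym low-w) z<s)
          (subst₂ _<_ (sym low-w) (sym len) (s≤s p≤n))
          (λ j j<low → ≮⇒≥ (below j (subst (j <_) low-w j<low)))
      , len
    where
    d = δ⁺ 0
    q = suc n ∸ p
    zeros = replicate p 0
    highs = replicate q (suc d)
    w = zeros ++ highs
    p+q≡ : p + q ≡ suc n
    p+q≡ = m+[n∸m]≡n (m≤n⇒m≤1+n p≤n)
    len : length w ≡ suc n
    len = trans (length-++ zeros)
            (trans (cong₂ _+_ (length-replicate p) (length-replicate q)) p+q≡)
    low-w : low d w ≡ p
    low-w = begin
      length (filter (_≤? d) w)
        ≡⟨ cong length (filter-++ (_≤? d) zeros highs) ⟩
      length (filter (_≤? d) zeros ++ filter (_≤? d) highs)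
        ≡⟨ cong₂ (λ s t → length (s ++ t)) (filter-all (_≤? d) (All.replicate⁺ p z≤n))
             (filter-none (_≤? d) (All.replicate⁺ q 1+n≰n)) ⟩
      length (zeros ++ [])
        ≡⟨ cong length (++-identityʳ zeros) ⟩
      length zeros
        ≡⟨ length-replicate p ⟩
      p ∎
      where open ≡-Reasoning
    high : ∀ j → p ≤ j → j < p + q → d < δ⁺ j
    high j p≤j j<p+q with m≤n⇒m<n∨m≡n p≤j | m≤n⇒m<n∨m≡n (s≤s⁻¹ (subst (j <_) p+q≡ j<p+q))
    ... | inj₂ refl | _         = d<p
    ... | inj₁ _    | inj₂ refl = 0<n
    -- A bound of at most `d` here would be a valley between the higher bounds at `p` and `n`.
    ... | inj₁ p<j  | inj₁ j<n  = ≰⇒> λ δj≤d →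
      unimodal (suc p) (suc j) (suc n) (s≤s p<j) (s≤s j<n)
        (≤-<-trans δj≤d d<p , ≤-<-trans δj≤d 0<n)
    cw : IsCliff δ w
    cw = from⇒cliff (glue zeros (from-replicate p λ _ _ _ → z≤n)
      (from-replicate q λ j o≤j j< → high j (subst (_≤ j) o≡p o≤j) (subst (λ o → j < o + q) o≡p j<)))
      where
      o≡p : length zeros + 0 ≡ p
      o≡p = trans (+-identityʳ _) (length-replicate p)

  bounded⇒dominated : Unimodal δ → ∃ PrimesBoundedBy → OneDominated δ
  -- An ascent at a position above `N` would give a prime of that same length.
  bounded⇒dominated unimodal (N , bound) = suc N , s≤s z≤n , λ
    { (suc n) (s≤s N≤n) → ≮⇒≥ λ 0<n → absurd N≤n (ascent⇒prime unimodal n 0<n) }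
    where
    absurd : ∀ {n} → N ≤ n → ¬ (∃[ w ] (IsPrime δ w × length w ≡ suc n))
    absurd N≤n (w , prime , len) = <⇒≱ (s≤s N≤n) (subst (_≤ N) len (bound w prime))

-- Bounded prime length and finiteness of the generating set.

module _ {r ℓ₁ ℓ₂ : Level} (K : HeytingField r ℓ₁ ℓ₂) (δ : RangeMap) (unimodal : Unimodal δ) where
  open CliffOperad K δ unimodal using (Comb; E; primeSet)
  open Offset δ
  open NSOperad (Cl K δ unimodal) using (O)
  private
    𝐎 = Cl K δ unimodal
    module R = CommutativeRing (fieldRing K)

  -- `≋` contains an equality of degrees, and the degree of a basis element is the length of its
  -- word; so each prime has the length of some listed element.
  finite⇒bounded : Finite 𝐎 primeSet → ∃ (PrimesBoundedBy δ)
  finite⇒bounded (xs , members) = max 0 arities , bound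
    where
    arities : List ℕ
    arities = map proj₁ xs
    bound : PrimesBoundedBy δ (max 0 arities)
    bound w prime with All.lookupAny (xs≤max 0 arities) (map⁺ (Any.map proj₁
      (Equivalence.to (members _)
        (mkCliff w (IsPrime.isCliff prime) refl , prime , λ _ → R.refl))))
    ... | arity≤ , |w|≡ = subst (_≤ max 0 arities) (sym |w|≡) arity≤

  primeElement : ∀ {w} → IsPrime δ w → ∃ O
  primeElement {w} prime = length w , E (mkCliff w (IsPrime.isCliff prime) refl)

  -- A list of at most one entry, so that `concatMap` drops the words that are not prime.
  primeElements : Word → List (∃ O)
  primeElements w with prime? δ w
  ... | yes prime = primeElement prime ∷ []
  ... | no _      = []

  primeElements⁺ : ∀ {p} {P : Pred (∃ O) p} w (prime : IsPrime δ w) →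
                   P (primeElement prime) → Any P (primeElements w)
  primeElements⁺ w prime Pw with prime? δ w
  -- The proof found by `prime?` may differ from the given one, but it enters `Cliff` only through
  -- an irrelevant field.
  ... | yes _      = here Pw
  ... | no ¬prime = contradiction prime ¬prime

  primeElements⁻ : ∀ {p} {P : Pred (∃ O) p} w → Any P (primeElements w) →
                   ∃[ prime ] P (primeElement {w} prime)
  primeElements⁻ w any with prime? δ w | any
  ... | yes prime | here Pw = prime , Pw

  -- Each letter is bounded by the range map, so there are finitely many cliffs of each length up to
  -- `N`.
  bounded⇒finite : ∃ (PrimesBoundedBy δ) → Finite 𝐎 primeSet
  bounded⇒finite (N , bound) = concatMap primeElements candidates , λ x → mk⇔ (to x) (from′ x)
    where
    candidates : List Word
    candidates = concatMap (words 0) (upTo (suc N))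
    to : ∀ {n} (x : Comb n) → GradedSubset.member primeSet x →
         Any (_≋_ 𝐎 (n , x)) (concatMap primeElements candidates)
    to x (W@(mkCliff w _ _) , prime , x≈E) = at (cliffLength W) W refl x≈E
      where
      -- The degree and the cliff are generalised so that both equalities can be matched with
      -- `refl`.
      at : ∀ {n} {x : Comb n} → length w ≡ n → (V : Cliff δ n) → Cliff.word V ≡ w →
           (∀ c → x c R.≈ E V c) → Any (_≋_ 𝐎 (n , x)) (concatMap primeElements candidates)
      at refl (mkCliff _ _ _) refl x≈E = concatMap⁺ primeElements (lose
        (∈-concatMap⁺ (words 0) (lose (∈-upTo⁺ (s≤s (bound w prime)))
          (∈-words (cliff⇒from (IsPrime.isCliff prime)))))
        (primeElements⁺ w prime (refl , x≈E)))
    from′ : ∀ {n} (x : Comb n) → Any (_≋_ 𝐎 (n , x)) (concatMap primeElements candidates) →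
            GradedSubset.member primeSet x
    from′ x any with Any.satisfied (concatMap⁻ primeElements {xs = candidates} any)
    ... | w , any-w with primeElements⁻ w any-w
    ...   | prime , refl , x≈E = mkCliff w (IsPrime.isCliff prime) refl , prime , x≈E

theorem2p3p3 : ∀ {r ℓ₁ ℓ₂ : Level} (K : HeytingField r ℓ₁ ℓ₂) → CharacteristicZero K →
    (δ : RangeMap) (unimodal : Unimodal δ) →
    Finite (Cl K δ unimodal) (MinimalGeneratingSet.generators (𝔊 K δ unimodal)) ⇔ OneDominated δ
theorem2p3p3 K _ δ unimodal = mk⇔
  (bounded⇒dominated δ unimodal ∘ finite⇒bounded K δ unimodal)
  (bounded⇒finite K δ unimodal ∘ dominated⇒bounded δ)
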